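{- Let $\mathbb{K}=\mathbb{R}$ or $\mathbb{C}$ and suppose that $\mathfrak{A},\mathfrak{B}\in GL_{l}(\mathbb{K})$ are such that $[\mathfrak{A},\mathfrak{B}]=\mathfrak{A}\mathfrak{B}-\mathfrak{B}\mathfrak{A}=0$. Then $$\mathfrak{Q}=(\mathfrak{A},\ \mathfrak{A}^{ -1}(I+\mathfrak{B}),\ (I+\mathfrak{A})\mathfrak{B}^{ -1},\ \mathfrak{B},\ \mathfrak{B}^{ -1}(I+\mathfrak{A}+\mathfrak{B})\mathfrak{A}^{ -1})$$ is a matrix frieze quiddity sequence of a two-sided matrix-valued frieze of period $5$.
   Context: Let $I$, $O$ be the $l\times l$ identity and zero matrices. A matrix-valued frieze of period $p$ (with $p-3$ non-trivial rows) is an array of $l\times l$ matrices $\mathfrak{M}_{i,j}$, $i,j\in\mathbb{Z}$ with $i-2\le j\le i+p-2$, which is $p$-periodic ($\mathfrak{M}_{i+p,j+p}=\mathfrak{M}_{i,j}$), with $\mathfrak{M}_{i,i-2}=O=\mathfrak{M}_{i,i+p-2}$, $\mathfrak{M}_{i,i-1}=I=\mathfrak{M}_{i,i+p-3}$, and with entries $\mathfrak{M}_{i,j}\in GL_{l}(\mathbb{K})$ in the non-trivial rows $i\le j\le i+p-4$ (the row of index $d$ consists of the entries with $j-i=d$). It is a left matrix-valued frieze if $$\mathfrak{M}_{i,j}\mathfrak{M}_{i+1,j+1}-\mathfrak{M}_{i,j+1}\mathfrak{M}_{i+1,j}=I$$ for all $i,j$ with $i-1\le j\le i+p-3$, a right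 matrix-valued frieze if $$\mathfrak{M}_{i+1,j+1}\mathfrak{M}_{i,j}-\mathfrak{M}_{i+1,j}\mathfrak{M}_{i,j+1}=I$$ for all such $i,j$, and two-sided if it is both left and right. Its matrix frieze quiddity sequence is $(\mathfrak{M}_{0,0},\mathfrak{M}_{1,1},\ldots,\mathfrak{M}_{p-1,p-1})$.
   Formalization: The formal theorem additionally assumes that I+A, I+B and I+A+B are invertible; this is necessary, since non-trivial frieze entries must lie in GL_l(K) and e.g. A=-I, B=I gives the entry (I+A)B^{ -1}=O. -}

module Defs where

open import Level using (Level; _⊔_)
open import Algebra.Apartness.Bundles using (HeytingCommutativeRing; HeytingField)
open import Algebra.Bundles using (CommutativeRing)
import Algebra.Definitions as AlgDefs
import Algebra.Properties.CommutativeMonoid.Sum as Sum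
open import Data.Bool.Base using (if_then_else_)
open import Data.Fin.Base using (Fin; toℕ)
open import Data.Fin.Properties using (_≟_)
open import Data.Integer.Base using (ℤ; +_; _≤_) renaming (_+_ to _+ℤ_; _-_ to _-ℤ_)
open import Data.Nat.Base using (ℕ)
open import Data.Product.Base using (_×_; ∃-syntax; proj₁)
open import Data.Vec.Functional using (Vector)
open import Relation.Nullary.Decidable.Core using (does)

-- HeytingField is the constructive notion of field: x # y holds exactly when
-- x - y is invertible, and # is tight.  Both ℝ and ℂ are Heyting fields.
module MatrixFriezes {c ℓ₁ ℓ₂ : Level} (K : HeytingField c ℓ₁ ℓ₂) (l : ℕ) where

  open HeytingField K
    using (Carrier; _≈_; 0#; 1#; heytingCommutativeRing)
    renaming (_+_ to _+ᴷ_; _*_ to _*ᴷ_; _-_ to _-ᴷ_)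

  commutativeRing : CommutativeRing c ℓ₁
  commutativeRing = HeytingCommutativeRing.commutativeRing heytingCommutativeRing

  open Sum (CommutativeRing.+-commutativeMonoid commutativeRing)
    using (sum-syntax)

  infix  4 _≈ᴹ_
  infixl 6 _⊕_ _⊖_
  infixl 7 _⊗_

  Matrix : Set c
  Matrix = Fin l → Fin l → Carrier

  _≈ᴹ_ : Matrix → Matrix → Set ℓ₁
  M ≈ᴹ N = ∀ r s → M r s ≈ N r s

  O : Matrix
  O r s = 0#

  I : Matrix
  I r s = if does (r ≟ s) then 1# else 0#

  _⊕_ : Matrix → Matrix → Matrix
  (M ⊕ N) r s = M r s +ᴷ N r s

  _⊖_ : Matrix → Matrix → Matrix
  (M ⊖ N) r s = M r s -ᴷ N r s

  _⊗_ : Matrix → Matrix → Matrix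
  (M ⊗ N) r s = ∑[ t < l ] (M r t *ᴷ N t s)

  [_,_] : Matrix → Matrix → Matrix
  [ M , N ] = M ⊗ N ⊖ N ⊗ M

  GL : Matrix → Set (c ⊔ ℓ₁)
  GL = AlgDefs.Invertible _≈ᴹ_ I _⊗_

  inverse : {M : Matrix} → GL M → Matrix
  inverse = proj₁

  -- Arrays are total functions; only the entries M i j with
  -- i - 2 ≤ j ≤ i + p - 2 belong to the frieze, the others are arbitrary.
  record IsMatrixFrieze (p : ℕ) (M : ℤ → ℤ → Matrix) : Set (c ⊔ ℓ₁) where
    field
      periodic   : ∀ i j → i -ℤ + 2 ≤ j → j ≤ i +ℤ + p -ℤ + 2 →
                   M (i +ℤ + p) (j +ℤ + p) ≈ᴹ M i j
      zeroRow    : ∀ i → M i (i -ℤ + 2) ≈ᴹ O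
      zeroRow′   : ∀ i → M i (i +ℤ + p -ℤ + 2) ≈ᴹ O
      oneRow     : ∀ i → M i (i -ℤ + 1) ≈ᴹ I
      oneRow′    : ∀ i → M i (i +ℤ + p -ℤ + 3) ≈ᴹ I
      invertible : ∀ i j → i ≤ j → j ≤ i +ℤ + p -ℤ + 4 → GL (M i j)

  record IsLeftMatrixFrieze (p : ℕ) (M : ℤ → ℤ → Matrix) : Set (c ⊔ ℓ₁) where
    field
      isMatrixFrieze : IsMatrixFrieze p M
      leftRule       : ∀ i j → i -ℤ + 1 ≤ j → j ≤ i +ℤ + p -ℤ + 3 →
                       M i j ⊗ M (i +ℤ + 1) (j +ℤ + 1)
                         ⊖ M i (j +ℤ + 1) ⊗ M (i +ℤ + 1) j ≈ᴹ I

  record IsRightMatrixFrieze (p : ℕ) (M : ℤ → ℤ → Matrix) : Set (c ⊔ ℓ₁) where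
    field
      isMatrixFrieze : IsMatrixFrieze p M
      rightRule      : ∀ i j → i -ℤ + 1 ≤ j → j ≤ i +ℤ + p -ℤ + 3 →
                       M (i +ℤ + 1) (j +ℤ + 1) ⊗ M i j
                         ⊖ M (i +ℤ + 1) j ⊗ M i (j +ℤ + 1) ≈ᴹ I

  IsTwoSidedMatrixFrieze : (p : ℕ) → (ℤ → ℤ → Matrix) → Set (c ⊔ ℓ₁)
  IsTwoSidedMatrixFrieze p M = IsLeftMatrixFrieze p M × IsRightMatrixFrieze p M

  quiddity : (p : ℕ) → (ℤ → ℤ → Matrix) → Vector Matrix p
  quiddity p M k = M (+ toℕ k) (+ toℕ k)

  IsTwoSidedQuiddity : (p : ℕ) → Vector Matrix p → Set (c ⊔ ℓ₁)
  IsTwoSidedQuiddity p Q =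
    ∃[ M ] IsTwoSidedMatrixFrieze p M × (∀ k → quiddity p M k ≈ᴹ Q k)

module Submission where

open import Defs
open import Level using (Level)
open import Algebra.Apartness.Bundles using (HeytingField)
open import Algebra.Bundles using (CommutativeMonoid; CommutativeRing; Ring)
import Algebra.Construct.Pointwise as Pointwise
import Algebra.Definitions as AlgDefs
import Algebra.Properties.CommutativeSemigroup as CommutativeSemigroupProperties
import Algebra.Properties.Group as GroupProperties
import Algebra.Properties.Monoid as MonoidProperties
import Algebra.Properties.Semiring.Sum as SemiringSum
open import Data.Bool.Base using (if_then_else_)
open import Data.Fin.Base using (Fin; zero; suc)
open import Data.Fin.Patterns using (0F; 1F; 2F; 3F; 4F)
open import Data.Fin.Properties using (_≟_)
open import Data.Integer.Base as ℤ
  using (ℤ; +_; -[1+_]; -1ℤ; _≤_; +≤+; -≤-; -≤+)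
import Data.Integer.Properties as ℤ
open import Data.Integer.Tactic.RingSolver using (solve-∀)
open import Data.Nat.Base using (ℕ; zero; suc; z≤n; s≤s)
open import Data.Nat.GeneralisedArithmetic using (fold)
open import Data.Product.Base using (_,_; proj₁; proj₂)
open import Data.Vec.Functional using (Vector; _∷_; [])
open import Function.Base using (_∘_)
open import Relation.Binary.PropositionalEquality as ≡ using (_≡_; cong; cong₂; subst)
import Relation.Binary.Reasoning.Setoid as SetoidReasoning
open import Relation.Nullary.Decidable.Core using (does)

-- Write q₀, …, q₄ for the proposed quiddity sequence, with indices mod 5.
-- Its entries all commute and satisfy the pentagon recurrence
-- q k * q (k + 1) = 1 + q (k + 3).  The first frieze rule therefore forces the
-- second non-trivial row to be q shifted by three places, and, since
-- 3 + 3 = 1 mod 5, the recurrence at k + 3 is exactly the second rule.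

-- Index arithmetic: residues modulo 5 and bounds on rows.

next : Fin 5 → Fin 5
next 0F = 1F
next 1F = 2F
next 2F = 3F
next 3F = 4F
next 4F = 0F

next³ : Fin 5 → Fin 5
next³ = next ∘ next ∘ next

next⁵ : ∀ k → next (next (next³ k)) ≡ k
next⁵ 0F = ≡.refl
next⁵ 1F = ≡.refl
next⁵ 2F = ≡.refl
next⁵ 3F = ≡.refl
next⁵ 4F = ≡.refl

-- Below zero, a step down is `next` applied four times, the inverse of `next` because `next` has
-- order 5. This makes `residue-suc` hold by computation except on the negative side, where it is
-- `next⁵`.
residue : ℤ → Fin 5
residue (+ zero)     = 0F
residue (+ suc n)    = next (residue (+ n))
residue -[1+ zero ]  = 4F
residue -[1+ suc n ] = next (next³ (residue -[1+ n ]))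

residue-suc : ∀ i → residue (ℤ.suc i) ≡ next (residue i)
residue-suc (+ n)        = ≡.refl
residue-suc -[1+ zero ]  = ≡.refl
residue-suc -[1+ suc n ] = ≡.sym (next⁵ (residue -[1+ n ]))

residue-+ : ∀ i n → residue (i ℤ.+ + n) ≡ fold (residue i) next n
residue-+ i zero    = cong residue (ℤ.+-identityʳ i)
residue-+ i (suc n) = begin
  residue (i ℤ.+ + suc n)         ≡⟨ cong residue (shift i (+ n)) ⟩
  residue (ℤ.suc (i ℤ.+ + n))     ≡⟨ residue-suc (i ℤ.+ + n) ⟩
  next (residue (i ℤ.+ + n))      ≡⟨ cong next (residue-+ i n) ⟩
  fold (residue i) next (suc n)   ∎
  where
  open ≡.≡-Reasoning
  shift : ∀ i j → i ℤ.+ (+ 1 ℤ.+ j) ≡ + 1 ℤ.+ (i ℤ.+ j)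
  shift = solve-∀

-- The frieze axioms bound `j` relative to `i`, while entries are given by cases on the row `j - i`.
-- This lemma and the next one translate the bounds into numerals that can be matched on.
i+d≤j⇒d≤j-i : ∀ d {i j} → i ℤ.+ d ≤ j → d ≤ j ℤ.- i
i+d≤j⇒d≤j-i d {i} {j} i+d≤j =
  subst (_≤ j ℤ.- i) (cancel i d) (ℤ.+-monoˡ-≤ (ℤ.- i) i+d≤j)
  where
  cancel : ∀ i d → i ℤ.+ d ℤ.- i ≡ d
  cancel = solve-∀

j≤i+p-m⇒j-i≤p-m : ∀ p m {i j} → j ≤ i ℤ.+ p ℤ.- m → j ℤ.- i ≤ p ℤ.- m
j≤i+p-m⇒j-i≤p-m p m {i} {j} j≤ =
  subst (j ℤ.- i ≤_) (cancel i p m) (ℤ.+-monoˡ-≤ (ℤ.- i) j≤)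
  where
  cancel : ∀ i p m → i ℤ.+ p ℤ.- m ℤ.- i ≡ p ℤ.- m
  cancel = solve-∀

-- Commuting elements and units of a ring.

module Commutation {r ℓ} (R : Ring r ℓ) where

  open Ring R
  open MonoidProperties *-monoid using (cancelˡ; cancelʳ; cancelᶜ)
  open GroupProperties +-group using (//-rightDividesʳ)
  open SetoidReasoning setoid

  Commute : Carrier → Carrier → Set ℓ
  Commute x y = x * y ≈ y * x

  Unit : Carrier → Set _
  Unit = AlgDefs.Invertible _≈_ 1# _*_

  unit-⁻¹ : ∀ {x} (u : Unit x) → Unit (u .proj₁)
  unit-⁻¹ {x} (_ , invˡ , invʳ) = x , invʳ , invˡ

  unit-* : ∀ {x y} → Unit x → Unit y → Unit (x * y)
  unit-* {x} {y} (x⁻¹ , x⁻¹x≈1 , xx⁻¹≈1) (y⁻¹ , y⁻¹y≈1 , yy⁻¹≈1) =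
      y⁻¹ * x⁻¹
    , trans (cancelᶜ x⁻¹x≈1 y⁻¹ y) y⁻¹y≈1
    , trans (cancelᶜ yy⁻¹≈1 x x⁻¹) xx⁻¹≈1

  x≈z+y⇒x-y≈z : ∀ {x y z} → x ≈ z + y → x - y ≈ z
  x≈z+y⇒x-y≈z {y = y} {z} x≈z+y = trans (+-congʳ x≈z+y) (//-rightDividesʳ y z)

  commute-0# : ∀ x → Commute x 0#
  commute-0# x = trans (zeroʳ x) (sym (zeroˡ x))

  commute-1# : ∀ x → Commute x 1#
  commute-1# x = trans (*-identityʳ x) (sym (*-identityˡ x))

  commute-+ : ∀ {x y z} → Commute x y → Commute x z → Commute x (y + z)
  commute-+ {x} {y} {z} xy xz = begin
    x * (y + z)    ≈⟨ distribˡ x y z ⟩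
    x * y + x * z  ≈⟨ +-cong xy xz ⟩
    y * x + z * x  ≈⟨ distribʳ x y z ⟨
    (y + z) * x    ∎

  commute-* : ∀ {x y z} → Commute x y → Commute x z → Commute x (y * z)
  commute-* {x} {y} {z} xy xz = begin
    x * (y * z)  ≈⟨ *-assoc x y z ⟨
    x * y * z    ≈⟨ *-congʳ xy ⟩
    y * x * z    ≈⟨ *-assoc y x z ⟩
    y * (x * z)  ≈⟨ *-congˡ xz ⟩
    y * (z * x)  ≈⟨ *-assoc y z x ⟨
    y * z * x    ∎

  -- Insert `y⁻¹ * y` in front of `x * y⁻¹`, move `y` past `x`, and cancel it against the final
  -- `y⁻¹`.
  commute-⁻¹ : ∀ {x y y⁻¹} → y⁻¹ * y ≈ 1# → y * y⁻¹ ≈ 1# →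
               Commute x y → Commute x y⁻¹
  commute-⁻¹ {x} {y} {y⁻¹} y⁻¹y≈1 yy⁻¹≈1 xy = begin
    x * y⁻¹              ≈⟨ cancelˡ y⁻¹y≈1 (x * y⁻¹) ⟨
    y⁻¹ * (y * (x * y⁻¹))  ≈⟨ *-congˡ (*-assoc y x y⁻¹) ⟨
    y⁻¹ * (y * x * y⁻¹)  ≈⟨ *-congˡ (*-congʳ xy) ⟨
    y⁻¹ * (x * y * y⁻¹)  ≈⟨ *-congˡ (cancelʳ yy⁻¹≈1 x) ⟩
    y⁻¹ * x              ∎

-- The pentagon recurrence for two commuting units.

module Pentagon {r ℓ} (R : Ring r ℓ) {a b : Ring.Carrier R}
  (a-unit : Commutation.Unit R a) (b-unit : Commutation.Unit R b)
  (ab≈ba : Commutation.Commute R a b) where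

  open Ring R
  open Commutation R
  open MonoidProperties *-monoid using (cancelˡ; cancelʳ)
  open CommutativeSemigroupProperties
    (CommutativeMonoid.commutativeSemigroup +-commutativeMonoid) using (xy∙z≈xz∙y; xy∙z≈y∙xz)
  open SetoidReasoning setoid

  private
    a⁻¹ b⁻¹ : Carrier
    a⁻¹ = a-unit .proj₁
    b⁻¹ = b-unit .proj₁

    a⁻¹a≈1 : a⁻¹ * a ≈ 1#
    a⁻¹a≈1 = a-unit .proj₂ .proj₁

    aa⁻¹≈1 : a * a⁻¹ ≈ 1#
    aa⁻¹≈1 = a-unit .proj₂ .proj₂

    b⁻¹b≈1 : b⁻¹ * b ≈ 1#
    b⁻¹b≈1 = b-unit .proj₂ .proj₁

    bb⁻¹≈1 : b * b⁻¹ ≈ 1#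
    bb⁻¹≈1 = b-unit .proj₂ .proj₂

  pentagon : Vector Carrier 5
  pentagon =
      a
    ∷ a⁻¹ * (1# + b)
    ∷ (1# + a) * b⁻¹
    ∷ b
    ∷ b⁻¹ * (1# + a + b) * a⁻¹
    ∷ []

  private
    commute-sum : ∀ {x} → Commute x a → Commute x b → Commute x (1# + a + b)
    commute-sum {x} xa xb = commute-+ (commute-+ (commute-1# x) xa) xb

    commute-a⁻¹ : ∀ {x} → Commute x a → Commute x a⁻¹
    commute-a⁻¹ = commute-⁻¹ a⁻¹a≈1 aa⁻¹≈1

    commute-b⁻¹ : ∀ {x} → Commute x b → Commute x b⁻¹
    commute-b⁻¹ = commute-⁻¹ b⁻¹b≈1 bb⁻¹≈1

  -- The centraliser of `x` is closed under sums, products and inverses, and every entry is built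
  -- from `1#`, `a` and `b` by these operations.
  commute-pentagon : ∀ {x} → Commute x a → Commute x b → ∀ k → Commute x (pentagon k)
  commute-pentagon xa xb 0F = xa
  commute-pentagon {x} xa xb 1F =
    commute-* (commute-a⁻¹ xa) (commute-+ (commute-1# x) xb)
  commute-pentagon {x} xa xb 2F =
    commute-* (commute-+ (commute-1# x) xa) (commute-b⁻¹ xb)
  commute-pentagon xa xb 3F = xb
  commute-pentagon xa xb 4F =
    commute-* (commute-* (commute-b⁻¹ xb) (commute-sum xa xb)) (commute-a⁻¹ xa)

  -- Two passes through `commute-pentagon`: first `a` and `b` commute with entry `j`, then entry `j`
  -- commutes with every entry.
  pentagon-commute : ∀ j k → Commute (pentagon j) (pentagon k)
  pentagon-commute j = commute-pentagon
    (sym (commute-pentagon refl ab≈ba j))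
    (sym (commute-pentagon (sym ab≈ba) refl j))

  -- Units are closed under products and inverses but not under sums, so the invertibility of the
  -- three sums is an input.
  pentagon-unit : Unit (1# + a) → Unit (1# + b) → Unit (1# + a + b) →
                  ∀ k → Unit (pentagon k)
  pentagon-unit 1+a 1+b 1+a+b 0F = a-unit
  pentagon-unit 1+a 1+b 1+a+b 1F = unit-* (unit-⁻¹ a-unit) 1+b
  pentagon-unit 1+a 1+b 1+a+b 2F = unit-* 1+a (unit-⁻¹ b-unit)
  pentagon-unit 1+a 1+b 1+a+b 3F = b-unit
  pentagon-unit 1+a 1+b 1+a+b 4F = unit-* (unit-* (unit-⁻¹ b-unit) 1+a+b) (unit-⁻¹ a-unit)

  private
    s : Carrier
    s = 1# + a + b

    product : (1# + b) * (1# + a) ≈ s + b * a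
    product = begin
      (1# + b) * (1# + a)            ≈⟨ distribˡ (1# + b) 1# a ⟩
      (1# + b) * 1# + (1# + b) * a   ≈⟨ +-cong (*-identityʳ (1# + b)) (distribʳ a 1# b) ⟩
      1# + b + (1# * a + b * a)      ≈⟨ +-congˡ (+-congʳ (*-identityˡ a)) ⟩
      1# + b + (a + b * a)           ≈⟨ +-assoc (1# + b) a (b * a) ⟨
      1# + b + a + b * a             ≈⟨ +-congʳ (xy∙z≈xz∙y 1# b a) ⟩
      s + b * a                      ∎

    -- The excess term `b * a` of the expanded product loses its `b` to `b⁻¹`. The remaining `a`
    -- supplies the `1#` of the recurrence at 1 once `a⁻¹` multiplies it.
    product-b⁻¹ : (1# + b) * ((1# + a) * b⁻¹) ≈ b⁻¹ * s + a
    product-b⁻¹ = begin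
      (1# + b) * ((1# + a) * b⁻¹)  ≈⟨ *-assoc (1# + b) (1# + a) b⁻¹ ⟨
      (1# + b) * (1# + a) * b⁻¹    ≈⟨ *-congʳ product ⟩
      (s + b * a) * b⁻¹            ≈⟨ commute-b⁻¹ (sym b-commute) ⟩
      b⁻¹ * (s + b * a)            ≈⟨ distribˡ b⁻¹ s (b * a) ⟩
      b⁻¹ * s + b⁻¹ * (b * a)      ≈⟨ +-congˡ (cancelˡ b⁻¹b≈1 a) ⟩
      b⁻¹ * s + a                  ∎
      where
      b-commute : Commute b (s + b * a)
      b-commute = commute-+ (commute-sum (sym ab≈ba) refl) (commute-* refl (sym ab≈ba))

    a⁻¹-commute : ∀ {x} → Commute a x → Commute a⁻¹ x
    a⁻¹-commute ax = sym (commute-a⁻¹ (sym ax))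

    b⁻¹-commute : ∀ {x} → Commute b x → Commute b⁻¹ x
    b⁻¹-commute bx = sym (commute-b⁻¹ (sym bx))

  -- At 0 and 2 an inverse cancels at once. At 3 and 4 the sum `s` is split as `a + (1# + b)` or
  -- `(1# + a) + b`, so that the remaining inverse turns one summand into `1#`. Only the case 1
  -- multiplies two sums.
  pentagon-recurrence : ∀ k → pentagon k * pentagon (next k) ≈ 1# + pentagon (next³ k)
  pentagon-recurrence 0F = cancelˡ aa⁻¹≈1 (1# + b)
  pentagon-recurrence 1F = begin
    a⁻¹ * (1# + b) * ((1# + a) * b⁻¹)    ≈⟨ *-assoc a⁻¹ (1# + b) _ ⟩
    a⁻¹ * ((1# + b) * ((1# + a) * b⁻¹))  ≈⟨ *-congˡ product-b⁻¹ ⟩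
    a⁻¹ * (b⁻¹ * s + a)                  ≈⟨ distribˡ a⁻¹ (b⁻¹ * s) a ⟩
    a⁻¹ * (b⁻¹ * s) + a⁻¹ * a            ≈⟨ +-cong (a⁻¹-commute a-commute) a⁻¹a≈1 ⟩
    b⁻¹ * s * a⁻¹ + 1#                   ≈⟨ +-comm _ 1# ⟩
    1# + b⁻¹ * s * a⁻¹                   ∎
    where
    a-commute : Commute a (b⁻¹ * s)
    a-commute = commute-* (commute-b⁻¹ ab≈ba) (commute-sum refl ab≈ba)
  pentagon-recurrence 2F = cancelʳ b⁻¹b≈1 (1# + a)
  pentagon-recurrence 3F = begin
    b * (b⁻¹ * s * a⁻¹)          ≈⟨ *-congˡ (*-assoc b⁻¹ s a⁻¹) ⟩
    b * (b⁻¹ * (s * a⁻¹))        ≈⟨ cancelˡ bb⁻¹≈1 (s * a⁻¹) ⟩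
    s * a⁻¹                      ≈⟨ a⁻¹-commute (commute-sum refl ab≈ba) ⟨
    a⁻¹ * s                      ≈⟨ *-congˡ (xy∙z≈y∙xz 1# a b) ⟩
    a⁻¹ * (a + (1# + b))         ≈⟨ distribˡ a⁻¹ a (1# + b) ⟩
    a⁻¹ * a + a⁻¹ * (1# + b)     ≈⟨ +-congʳ a⁻¹a≈1 ⟩
    1# + a⁻¹ * (1# + b)          ∎
  pentagon-recurrence 4F = begin
    b⁻¹ * s * a⁻¹ * a            ≈⟨ cancelʳ a⁻¹a≈1 (b⁻¹ * s) ⟩
    b⁻¹ * s                      ≈⟨ b⁻¹-commute (commute-sum (sym ab≈ba) refl) ⟩
    s * b⁻¹                      ≈⟨ distribʳ b⁻¹ (1# + a) b ⟩
    (1# + a) * b⁻¹ + b * b⁻¹     ≈⟨ +-congˡ bb⁻¹≈1 ⟩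
    (1# + a) * b⁻¹ + 1#          ≈⟨ +-comm _ 1# ⟩
    1# + (1# + a) * b⁻¹          ∎

-- Entries of the frieze with first row q, indexed by the row d = j - i and by
-- the residue k of i; rows outside -2 ≤ d ≤ 3 are junk.
module FriezeEntries {r ℓ} (R : Ring r ℓ) (q : Vector (Ring.Carrier R) 5) where

  open Ring R
  open Commutation R

  entry : ℤ → Fin 5 → Carrier
  entry -[1+ 0 ] k = 1#
  entry (+ 0)    k = q k
  entry (+ 1)    k = q (next³ k)
  entry (+ 2)    k = 1#
  entry _        k = 0#

  commute-entry : ∀ {x} → (∀ k → Commute x (q k)) → ∀ d k → Commute x (entry d k)
  commute-entry {x} xq -[1+ 0 ]                k = commute-1# x
  commute-entry {x} xq -[1+ suc n ]            k = commute-0# x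
  commute-entry {x} xq (+ 0)                   k = xq k
  commute-entry {x} xq (+ 1)                   k = xq (next³ k)
  commute-entry {x} xq (+ 2)                   k = commute-1# x
  commute-entry {x} xq (+ suc (suc (suc n)))   k = commute-0# x

  entry-commute : (∀ j k → Commute (q j) (q k)) →
                  ∀ d e j k → Commute (entry d j) (entry e k)
  entry-commute qq d e j = commute-entry
    (λ k → sym (commute-entry (qq k) d j)) e

  entry-unit : (∀ k → Unit (q k)) → ∀ {d} → + 0 ≤ d → d ≤ + 1 → ∀ k → Unit (entry d k)
  entry-unit u (+≤+ _) (+≤+ z≤n)       k = u k
  entry-unit u (+≤+ _) (+≤+ (s≤s z≤n)) k = u (next³ k)

  -- Rows 0 and 1 are the recurrence at `k` and at `next³ k`. In rows -1 and 2 the rule reads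
  -- `1# * 1# - 0# ≈ 1#`, since the default value of `entry` provides the zero rows -2 and 3.
  diamond : (∀ k → q k * q (next k) ≈ 1# + q (next³ k)) →
            ∀ {d} → -1ℤ ≤ d → d ≤ + 2 → ∀ k →
            entry d k * entry d (next k)
              - entry (d ℤ.+ + 1) k * entry (d ℤ.- + 1) (next k) ≈ 1#
  diamond rec {d} -1≤d d≤2 k = x≈z+y⇒x-y≈z (rule -1≤d d≤2)
    where
    rule : ∀ {d} → -1ℤ ≤ d → d ≤ + 2 →
           entry d k * entry d (next k)
             ≈ 1# + entry (d ℤ.+ + 1) k * entry (d ℤ.- + 1) (next k)
    -- Matching on the two bounds leaves exactly the rows -1, 0, 1 and 2.
    rule (-≤- z≤n) _ = trans (*-identityˡ 1#)
      (sym (trans (+-congˡ (zeroʳ (q k))) (+-identityʳ 1#)))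
    rule -≤+ (+≤+ z≤n) = trans (rec k) (+-congˡ (sym (*-identityʳ _)))
    -- Six steps of `next` equal one, by `next⁵`, which brings the right-hand side back to
    -- `q (next k)`.
    rule -≤+ (+≤+ (s≤s z≤n)) = trans (rec (next³ k))
      (+-congˡ (trans (reflexive (cong (q ∘ next) (next⁵ k))) (sym (*-identityˡ _))))
    rule -≤+ (+≤+ (s≤s (s≤s z≤n))) = trans (*-identityˡ 1#)
      (sym (trans (+-congˡ (zeroˡ _)) (+-identityʳ 1#)))

-- Sums against the Kronecker delta.

module _ {c ℓ} (R : CommutativeRing c ℓ) where

  open CommutativeRing R hiding (zero)
  open SemiringSum semiring using (sum-syntax; sum-cong-≋; sum-replicate-zero)

  private
    δ : ∀ {n} → Fin n → Fin n → Carrier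
    δ r s = if does (r ≟ s) then 1# else 0#

  ∑-δˡ : ∀ {n} r (f : Vector Carrier n) → ∑[ t < n ] (δ r t * f t) ≈ f r
  ∑-δˡ {suc n} zero    f = trans
    (+-cong (*-identityˡ (f zero))
            (trans (sum-cong-≋ (λ t → zeroˡ (f (suc t)))) (sum-replicate-zero n)))
    (+-identityʳ (f zero))
  ∑-δˡ {suc n} (suc r) f =
    trans (+-cong (zeroˡ (f zero)) (∑-δˡ r (f ∘ suc))) (+-identityˡ (f (suc r)))

  ∑-δʳ : ∀ {n} s (f : Vector Carrier n) → ∑[ t < n ] (f t * δ t s) ≈ f s
  ∑-δʳ {suc n} zero    f = trans
    (+-cong (*-identityʳ (f zero))
            (trans (sum-cong-≋ (λ t → zeroʳ (f (suc t)))) (sum-replicate-zero n)))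
    (+-identityʳ (f zero))
  ∑-δʳ {suc n} (suc s) f =
    trans (+-cong (zeroʳ (f zero)) (∑-δʳ s (f ∘ suc))) (+-identityˡ (f (suc s)))

-- The ring of square matrices.

module MatrixRing {c ℓ₁ ℓ₂ : Level} (K : HeytingField c ℓ₁ ℓ₂) (l : ℕ) where

  open MatrixFriezes K l
  open CommutativeRing commutativeRing
  open SemiringSum semiring
  open SetoidReasoning setoid

  ⊗-assoc : ∀ M N P → (M ⊗ N) ⊗ P ≈ᴹ M ⊗ (N ⊗ P)
  ⊗-assoc M N P r s = begin
    ∑[ t < l ] (∑[ u < l ] (M r u * N u t) * P t s)
      ≈⟨ sum-cong-≋ (λ t → *-distribʳ-sum (P t s) (λ u → M r u * N u t)) ⟩
    ∑[ t < l ] ∑[ u < l ] (M r u * N u t * P t s)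
      ≈⟨ ∑-comm (λ t u → M r u * N u t * P t s) ⟩
    ∑[ u < l ] ∑[ t < l ] (M r u * N u t * P t s)
      ≈⟨ sum-cong-≋ (λ u → sum-cong-≋ (λ t → *-assoc (M r u) (N u t) (P t s))) ⟩
    ∑[ u < l ] ∑[ t < l ] (M r u * (N u t * P t s))
      ≈⟨ sum-cong-≋ (λ u → *-distribˡ-sum (M r u) (λ t → N u t * P t s)) ⟨
    ∑[ u < l ] (M r u * ∑[ t < l ] (N u t * P t s))
      ∎

  ⊗-distribˡ-⊕ : ∀ M N P → M ⊗ (N ⊕ P) ≈ᴹ M ⊗ N ⊕ M ⊗ P
  ⊗-distribˡ-⊕ M N P r s = trans
    (sum-cong-≋ (λ t → distribˡ (M r t) (N t s) (P t s)))
    (∑-distrib-+ (λ t → M r t * N t s) (λ t → M r t * P t s))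

  ⊗-distribʳ-⊕ : ∀ M N P → (N ⊕ P) ⊗ M ≈ᴹ N ⊗ M ⊕ P ⊗ M
  ⊗-distribʳ-⊕ M N P r s = trans
    (sum-cong-≋ (λ t → distribʳ (M t s) (N r t) (P r t)))
    (∑-distrib-+ (λ t → N r t * M t s) (λ t → P r t * M t s))

  matrixRing : Ring c ℓ₁
  matrixRing = record
    { Carrier = Matrix
    ; _≈_     = _≈ᴹ_
    ; _+_     = _⊕_
    ; _*_     = _⊗_
    ; -_      = λ M r s → - M r s
    ; 0#      = O
    ; 1#      = I
    ; isRing  = record
      { +-isAbelianGroup =
          -- One pointwise lifting for the row index and one for the column index.
          Pointwise.isAbelianGroup (Fin l) (Pointwise.isAbelianGroup (Fin l) +-isAbelianGroup)
      ; *-cong     = λ M≈M′ N≈N′ r s → sum-cong-≋ (λ t → *-cong (M≈M′ r t) (N≈N′ t s))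
      ; *-assoc    = ⊗-assoc
      ; *-identity =
            (λ M r s → ∑-δˡ commutativeRing r (λ t → M t s))
          , (λ M r s → ∑-δʳ commutativeRing s (M r))
      ; distrib    = ⊗-distribˡ-⊕ , ⊗-distribʳ-⊕
      }
    }

-- From the recurrence to a two-sided frieze.

module _ {c ℓ₁ ℓ₂ : Level} (K : HeytingField c ℓ₁ ℓ₂) (l : ℕ) where

  open MatrixFriezes K l
  open Ring (MatrixRing.matrixRing K l) using (reflexive; sym; trans; +-cong; -‿cong)
  open Commutation (MatrixRing.matrixRing K l) using (Commute)

  -- Invertibility of `q` gives the non-trivial rows, the recurrence gives the left rule, and
  -- commutativity turns the left rule into the right one.
  recurrence⇒quiddity : (q : Vector Matrix 5) →
    (∀ k → GL (q k)) →
    (∀ j k → q j ⊗ q k ≈ᴹ q k ⊗ q j) →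
    (∀ k → q k ⊗ q (next k) ≈ᴹ I ⊕ q (next³ k)) →
    IsTwoSidedQuiddity 5 q
  recurrence⇒quiddity q q-unit q-commute recurrence = M , (isLeft , isRight) , λ where
      -- For a concrete index the row evaluates to 0 and the residue to the index itself, so the
      -- diagonal entry computes to the entry of `q`.
      0F → reflexive ≡.refl
      1F → reflexive ≡.refl
      2F → reflexive ≡.refl
      3F → reflexive ≡.refl
      4F → reflexive ≡.refl
    where
    open FriezeEntries (MatrixRing.matrixRing K l) q

    M : ℤ → ℤ → Matrix
    M i j = entry (j ℤ.- i) (residue i)

    isMatrixFrieze : IsMatrixFrieze 5 M
    isMatrixFrieze = record
      { periodic   = λ i j _ _ → reflexive (cong₂ entry (period i j) (residue-+5 i))
      ; zeroRow    = λ i → row (offset i (+ 2))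
      ; zeroRow′   = λ i → row (offset′ i (+ 5) (+ 2))
      ; oneRow     = λ i → row (offset i (+ 1))
      ; oneRow′    = λ i → row (offset′ i (+ 5) (+ 3))
      ; invertible = λ i j i≤j j≤ →
          entry-unit q-unit (ℤ.i≤j⇒0≤j-i i≤j) (j≤i+p-m⇒j-i≤p-m (+ 5) (+ 4) j≤) (residue i)
      }
      where
      row : ∀ {d e k} → d ≡ e → entry d k ≈ᴹ entry e k
      row {k = k} d≡e = reflexive (cong (λ d → entry d k) d≡e)

      residue-+5 : ∀ i → residue (i ℤ.+ + 5) ≡ residue i
      residue-+5 i = ≡.trans (residue-+ i 5) (next⁵ (residue i))

      period : ∀ i j → j ℤ.+ + 5 ℤ.- (i ℤ.+ + 5) ≡ j ℤ.- i
      period = solve-∀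

      offset : ∀ i m → i ℤ.- m ℤ.- i ≡ ℤ.- m
      offset = solve-∀

      offset′ : ∀ i p m → i ℤ.+ p ℤ.- m ℤ.- i ≡ p ℤ.- m
      offset′ = solve-∀

    -- This and the next two equations rewrite the neighbours of `M i j` in row and residue
    -- coordinates, the form in which `diamond` is stated.
    diag : ∀ i j → M (i ℤ.+ + 1) (j ℤ.+ + 1) ≡ entry (j ℤ.- i) (next (residue i))
    diag i j = cong₂ entry (shift i j) (residue-+ i 1)
      where
      shift : ∀ i j → j ℤ.+ + 1 ℤ.- (i ℤ.+ + 1) ≡ j ℤ.- i
      shift = solve-∀

    above : ∀ i j → M i (j ℤ.+ + 1) ≡ entry (j ℤ.- i ℤ.+ + 1) (residue i)
    above i j = cong (λ d → entry d (residue i)) (shift i j)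
      where
      shift : ∀ i j → j ℤ.+ + 1 ℤ.- i ≡ j ℤ.- i ℤ.+ + 1
      shift = solve-∀

    below : ∀ i j → M (i ℤ.+ + 1) j ≡ entry (j ℤ.- i ℤ.- + 1) (next (residue i))
    below i j = cong₂ entry (shift i j) (residue-+ i 1)
      where
      shift : ∀ i j → j ℤ.- (i ℤ.+ + 1) ≡ j ℤ.- i ℤ.- + 1
      shift = solve-∀

    leftRule : ∀ i j → i ℤ.- + 1 ≤ j → j ≤ i ℤ.+ + 5 ℤ.- + 3 →
               M i j ⊗ M (i ℤ.+ + 1) (j ℤ.+ + 1)
                 ⊖ M i (j ℤ.+ + 1) ⊗ M (i ℤ.+ + 1) j ≈ᴹ I
    leftRule i j i-1≤j j≤i+2 = trans
      (reflexive (cong₂ _⊖_ (cong (M i j ⊗_) (diag i j)) (cong₂ _⊗_ (above i j) (below i j))))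
      (diamond recurrence (i+d≤j⇒d≤j-i -1ℤ i-1≤j)
        (j≤i+p-m⇒j-i≤p-m (+ 5) (+ 3) j≤i+2) (residue i))

    M-commute : ∀ i j i′ j′ → Commute (M i j) (M i′ j′)
    M-commute i j i′ j′ =
      entry-commute q-commute (j ℤ.- i) (j′ ℤ.- i′) (residue i) (residue i′)

    isLeft : IsLeftMatrixFrieze 5 M
    isLeft = record { isMatrixFrieze = isMatrixFrieze ; leftRule = leftRule }

    isRight : IsRightMatrixFrieze 5 M
    isRight = record
      { isMatrixFrieze = isMatrixFrieze
      -- Any two entries commute, so swapping the factors of both products yields the left rule.
      ; rightRule      = λ i j i-1≤j j≤i+2 → trans
          (+-cong (M-commute (i ℤ.+ + 1) (j ℤ.+ + 1) i j)
                  (-‿cong (M-commute (i ℤ.+ + 1) j i (j ℤ.+ + 1))))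
          (leftRule i j i-1≤j j≤i+2)
      }

-- The diagonal entries of a frieze lie in `GL`; with `A` and `B` invertible this forces `I ⊕ A`,
-- `I ⊕ B` and `I ⊕ A ⊕ B` to be invertible, hence the three hypotheses on sums.
theorem43 : {c ℓ₁ ℓ₂ : Level} (K : HeytingField c ℓ₁ ℓ₂) (l : ℕ) →
    let open MatrixFriezes K l in
    (A B : Matrix) (A∈GL : GL A) (B∈GL : GL B) →
    [ A , B ] ≈ᴹ O →
    GL (I ⊕ A) → GL (I ⊕ B) → GL (I ⊕ A ⊕ B) →
    let A⁻¹ = inverse A∈GL
        B⁻¹ = inverse B∈GL
    in IsTwoSidedQuiddity 5
         ( A
         ∷ A⁻¹ ⊗ (I ⊕ B)
         ∷ (I ⊕ A) ⊗ B⁻¹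
         ∷ B
         ∷ B⁻¹ ⊗ (I ⊕ A ⊕ B) ⊗ A⁻¹
         ∷ [] )
theorem43 K l A B A∈GL B∈GL [A,B]≈O I+A∈GL I+B∈GL I+A+B∈GL =
  recurrence⇒quiddity K l pentagon
    (pentagon-unit I+A∈GL I+B∈GL I+A+B∈GL)
    pentagon-commute
    pentagon-recurrence
  where
  open MatrixFriezes K l
  open Ring (MatrixRing.matrixRing K l) using (+-group)
  open GroupProperties +-group using (x∙y⁻¹≈ε⇒x≈y)
  open Pentagon (MatrixRing.matrixRing K l) A∈GL B∈GL
    (x∙y⁻¹≈ε⇒x≈y (A ⊗ B) (B ⊗ A) [A,B]≈O)
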